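{- Let $R \cong R_1\times\cdots\times R_r$ ($r\ge 1$) with finite commutative local rings $R_i$. Then the number of non-zero zero-divisors of $R$, i.e. the number of vertices of the zero-divisor graph $\Gamma(R)$, equals $$\# V(\Gamma(R)) = \prod_{i=1}^r \# R_i - \prod_{i=1}^r \# V(\mathrm U(R_i)) - 1 = \prod_{i=1}^r \# R_i - \prod_{i=1}^r \# U(R_i) - 1 .$$
   Context: Rings are finite and commutative with $1\neq 0$. The zero-divisor graph $\Gamma(R)$ has as vertex set $Z^*(R)$ the set of non-zero zero-divisors of $R$, with $x,y$ adjacent iff $xy=0$. $U(R)$ denotes the set of units of $R$, and the graph $\mathrm U(R_i)$ (the unit graph) has vertex set $U(R_i)$ and no edges. $\#S$ is the cardinality of a set $S$. -}

module Defs where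

open import Algebra.Bundles using (CommutativeRing)
open import Algebra.Definitions using (Invertible)
open import Algebra.Morphism.Structures using (module RingMorphisms)
open import Data.Empty using (⊥)
open import Data.Fin.Base using (Fin; zero; suc)
import Data.Fin.Properties as Fin
open import Data.List.Base using (tabulate)
open import Data.Nat.Base using (ℕ; zero; suc)
open import Data.Nat.ListAction using (product)
open import Data.Product.Base using (Σ; ∃; _×_; _,_; proj₁; proj₂)
open import Function.Base using (_∘_)
open import Function.Bundles using (Inverse)
import Function.Construct.Composition as Composition
open import Level using (Level; _⊔_; 0ℓ) renaming (suc to lsuc)
open import Relation.Binary.Bundles using (Setoid)
open import Relation.Binary.Core using (Rel)
import Relation.Binary.Construct.On as On
import Relation.Binary.Definitions as B
open import Relation.Binary.PropositionalEquality
  using (_≡_; refl; cong; setoid)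
open import Relation.Nullary.Decidable using (Dec; yes; no; map′; _×-dec_; ¬?)
open import Relation.Nullary.Negation using (¬_; contradiction)
open import Relation.Unary using (Pred; Decidable; _∈_; _⊆_; _≐_; _∩_)

private
  variable
    a b c c′ ℓ ℓ′ p : Level

record FiniteSetoid a ℓ : Set (lsuc (a ⊔ ℓ)) where
  field
    carrier     : Setoid a ℓ
    size        : ℕ
    enumeration : Inverse carrier (setoid (Fin size))

infix 9 #_

#_ : FiniteSetoid a ℓ → ℕ
#_ = FiniteSetoid.size

∏ : ∀ {r} → (Fin r → ℕ) → ℕ
∏ f = product (tabulate f)

-- Equality on the subset { x ∈ S | P x } ignores the membership proof, so
-- each element of S is counted at most once.
subsetoid : (S : Setoid a ℓ) → Pred (Setoid.Carrier S) p → Setoid (a ⊔ p) ℓ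
subsetoid S P = On.setoid {B = Σ (Setoid.Carrier S) P} S proj₁

module _ where

  open Inverse

  private
    skip : ∀ {n} {P : Pred (Fin (suc n)) p} → ¬ P zero →
           Inverse (subsetoid (setoid (Fin (suc n))) P)
                   (subsetoid (setoid (Fin n)) (P ∘ suc))
    skip {n = n} {P = P} ¬p₀ = record
      { to        = f
      ; from      = λ (i , q) → suc i , q
      ; to-cong   = λ {x} {y} → f-cong x y
      ; from-cong = cong suc
      ; inverse   = (λ { {x} {suc i , q} e → Fin.suc-injective e
                       ; {x} {zero , q} e → contradiction q ¬p₀ })
                  , (λ {x} {y} e → inv x y e)
      }
      where
      f : Σ (Fin (suc n)) P → Σ (Fin n) (P ∘ suc)
      f (zero  , q) = contradiction q ¬p₀
      f (suc i , q) = i , q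

      f-cong : ∀ x y → proj₁ x ≡ proj₁ y → proj₁ (f x) ≡ proj₁ (f y)
      f-cong (zero  , q) _            _    = contradiction q ¬p₀
      f-cong (suc i , q) (suc .i , _) refl = refl

      inv : ∀ x y → proj₁ y ≡ proj₁ (f x) → suc (proj₁ y) ≡ proj₁ x
      inv (zero  , q) _ _ = contradiction q ¬p₀
      inv (suc i , q) _ e = cong suc e

    keep : ∀ {n m} {P : Pred (Fin (suc n)) p} → P zero →
           Inverse (subsetoid (setoid (Fin n)) (P ∘ suc)) (setoid (Fin m)) →
           Inverse (subsetoid (setoid (Fin (suc n))) P) (setoid (Fin (suc m)))
    keep {n = n} {m} {P} p₀ I = record
      { to        = f
      ; from      = g
      ; to-cong   = λ {x} {y} → f-cong x y
      ; from-cong = λ { refl → refl }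
      ; inverse   = (λ {x} {y} → invˡ x y) , (λ {x} {y} → invʳ x y)
      }
      where
      f : Σ (Fin (suc n)) P → Fin (suc m)
      f (zero  , _) = zero
      f (suc i , q) = suc (to I (i , q))

      g : Fin (suc m) → Σ (Fin (suc n)) P
      g zero    = zero , p₀
      g (suc j) = suc (proj₁ (from I j)) , proj₂ (from I j)

      f-cong : ∀ x y → proj₁ x ≡ proj₁ y → f x ≡ f y
      f-cong (zero  , _) (zero   , _) _    = refl
      f-cong (suc i , _) (suc .i , _) refl = cong suc (to-cong I refl)

      invˡ : ∀ j x → proj₁ x ≡ proj₁ (g j) → f x ≡ j
      invˡ zero    (zero  , _) _ = refl
      invˡ (suc j) (suc i , _) e = cong suc (inverseˡ I (Fin.suc-injective e))

      invʳ : ∀ x j → j ≡ f x → proj₁ (g j) ≡ proj₁ x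
      invʳ (zero  , _) _ refl = refl
      invʳ (suc i , _) _ refl = cong suc (inverseʳ I refl)

    count : ∀ n {P : Pred (Fin n) p} → Decidable P →
            ∃ λ m → Inverse (subsetoid (setoid (Fin n)) P) (setoid (Fin m))
    count zero P? = 0 , record
      { to        = proj₁
      ; from      = λ ()
      ; to-cong   = λ e → e
      ; from-cong = λ { {()} }
      ; inverse   = (λ { {()} }) , (λ { {() , _} })
      }
    count (suc n) P? with P? zero | count n (P? ∘ suc)
    ... | yes p₀ | m , I = suc m , keep p₀ I
    ... | no ¬p₀ | m , I = m , Composition.inverse (skip ¬p₀) I

  module _ (S : FiniteSetoid a ℓ) where

    open FiniteSetoid S
    open Setoid carrier using (Carrier; _≈_; sym; trans)

    private
      pull : {P : Pred Carrier p} → P B.Respects _≈_ →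
             Inverse (subsetoid carrier P)
                     (subsetoid (setoid (Fin size)) (P ∘ from enumeration))
      pull resp = record
        { to        = λ (x , q) →
                      to enumeration x , resp (sym (inverseʳ enumeration refl)) q
        ; from      = λ (i , q) → from enumeration i , q
        ; to-cong   = to-cong enumeration
        ; from-cong = from-cong enumeration
        ; inverse   = inverseˡ enumeration , inverseʳ enumeration
        }

    subset : (P : Pred Carrier p) → P B.Respects _≈_ → Decidable P →
             FiniteSetoid (a ⊔ p) ℓ
    subset P resp P? = record
      { carrier     = subsetoid carrier P
      ; size        = proj₁ counted
      ; enumeration = Composition.inverse (pull resp) (proj₂ counted)
      }
      where counted = count size (P? ∘ from enumeration)

    finite-∃? : {P : Pred Carrier p} → P B.Respects _≈_ → Decidable P →
                Dec (∃ P)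
    finite-∃? resp P? = map′
      (λ (i , q) → from enumeration i , q)
      (λ (x , q) → to enumeration x , resp (sym (inverseʳ enumeration refl)) q)
      (Fin.any? (P? ∘ from enumeration))

    finite-≟ : B.Decidable _≈_
    finite-≟ x y = map′
      (λ e → trans (sym (inverseʳ enumeration refl)) (inverseʳ enumeration e))
      (to-cong enumeration)
      (to enumeration x Fin.≟ to enumeration y)

record FiniteCommutativeRing c ℓ : Set (lsuc (c ⊔ ℓ)) where
  field
    commutativeRing : CommutativeRing c ℓ

  open CommutativeRing commutativeRing public
    hiding (zero) renaming (setoid to ≈-setoid)

  field
    size        : ℕ
    enumeration : Inverse ≈-setoid (setoid (Fin size))
    1≉0         : ¬ (1# ≈ 0#)

  elements : FiniteSetoid c ℓ
  elements = record
    { carrier = ≈-setoid ; size = size ; enumeration = enumeration }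

open FiniteCommutativeRing public using (commutativeRing; elements)

_≅_ : CommutativeRing c ℓ → CommutativeRing c′ ℓ′ → Set _
R ≅ S = ∃ (RingMorphisms.IsRingIsomorphism
            (CommutativeRing.rawRing R) (CommutativeRing.rawRing S))

∏ᴿ : ∀ {r} → (Fin r → CommutativeRing c ℓ) → CommutativeRing c ℓ
∏ᴿ R = record
  { Carrier = ∀ i → R.Carrier i
  ; _≈_     = λ x y → ∀ i → R._≈_ i (x i) (y i)
  ; _+_     = λ x y i → R._+_ i (x i) (y i)
  ; _*_     = λ x y i → R._*_ i (x i) (y i)
  ; -_      = λ x i → R.-_ i (x i)
  ; 0#      = λ i → R.0# i
  ; 1#      = λ i → R.1# i
  ; isCommutativeRing = record
    { isRing = record
      { +-isAbelianGroup = record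
        { isGroup = record
          { isMonoid = record
            { isSemigroup = record
              { isMagma = record
                { isEquivalence = record
                  { refl  = λ i → R.refl i
                  ; sym   = λ e i → R.sym i (e i)
                  ; trans = λ e f i → R.trans i (e i) (f i)
                  }
                ; ∙-cong = λ e f i → R.+-cong i (e i) (f i)
                }
              ; assoc = λ x y z i → R.+-assoc i (x i) (y i) (z i)
              }
            ; identity = (λ x i → R.+-identityˡ i (x i))
                       , (λ x i → R.+-identityʳ i (x i))
            }
          ; inverse = (λ x i → R.-‿inverseˡ i (x i))
                    , (λ x i → R.-‿inverseʳ i (x i))
          ; ⁻¹-cong = λ e i → R.-‿cong i (e i)
          }
        ; comm = λ x y i → R.+-comm i (x i) (y i)
        }
      ; *-cong     = λ e f i → R.*-cong i (e i) (f i)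
      ; *-assoc    = λ x y z i → R.*-assoc i (x i) (y i) (z i)
      ; *-identity = (λ x i → R.*-identityˡ i (x i))
                   , (λ x i → R.*-identityʳ i (x i))
      ; distrib    = (λ x y z i → R.distribˡ i (x i) (y i) (z i))
                   , (λ x y z i → R.distribʳ i (x i) (y i) (z i))
      }
    ; *-comm = λ x y i → R.*-comm i (x i) (y i)
    }
  }
  where module R i = CommutativeRing (R i)

module _ (R : CommutativeRing c ℓ) where

  open CommutativeRing R

  record IsIdeal (I : Pred Carrier p) : Set (c ⊔ ℓ ⊔ p) where
    field
      resp     : I B.Respects _≈_
      0∈       : 0# ∈ I
      +-closed : ∀ {x y} → x ∈ I → y ∈ I → x + y ∈ I
      *-closed : ∀ r {x} → x ∈ I → r * x ∈ I

  Proper : Pred Carrier p → Set _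
  Proper I = ¬ (∀ x → x ∈ I)

  -- Ideals range over predicates of level c ⊔ ℓ, the level of
  -- "x is not invertible".
  record IsMaximalIdeal (M : Pred Carrier (c ⊔ ℓ)) : Set (lsuc (c ⊔ ℓ)) where
    field
      isIdeal : IsIdeal M
      proper  : Proper M
      maximal : ∀ (J : Pred Carrier (c ⊔ ℓ)) → IsIdeal J → Proper J →
                M ⊆ J → J ⊆ M

  IsLocal : Set _
  IsLocal = ∃ λ M → IsMaximalIdeal M × (∀ N → IsMaximalIdeal N → N ≐ M)

module _ (R : FiniteCommutativeRing c ℓ) where

  open FiniteCommutativeRing R hiding (elements)

  private
    _≟_ = finite-≟ (elements R)

  IsUnit : Pred Carrier _
  IsUnit = Invertible _≈_ 1# _*_

  IsZeroDivisor : Pred Carrier _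
  IsZeroDivisor x = ∃ λ y → ¬ (y ≈ 0#) × x * y ≈ 0#

  IsNonZeroZeroDivisor : Pred Carrier _
  IsNonZeroZeroDivisor x = ¬ (x ≈ 0#) × IsZeroDivisor x

  isUnit-resp : IsUnit B.Respects _≈_
  isUnit-resp e (y , yx , xy) =
    y , trans (*-congˡ (sym e)) yx , trans (*-congʳ (sym e)) xy

  isUnit? : Decidable IsUnit
  isUnit? x = finite-∃? (elements R)
    (λ e (yx , xy) → trans (*-congʳ (sym e)) yx , trans (*-congˡ (sym e)) xy)
    (λ y → ((y * x) ≟ 1#) ×-dec ((x * y) ≟ 1#))

  isNonZeroZeroDivisor-resp : IsNonZeroZeroDivisor B.Respects _≈_
  isNonZeroZeroDivisor-resp e (x≉0 , y , y≉0 , xy) =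
    (λ x≈0 → x≉0 (trans e x≈0)) , y , y≉0 , trans (*-congʳ (sym e)) xy

  isNonZeroZeroDivisor? : Decidable IsNonZeroZeroDivisor
  isNonZeroZeroDivisor? x = ¬? (x ≟ 0#) ×-dec finite-∃? (elements R)
    (λ e (y≉0 , xy) → (λ y≈0 → y≉0 (trans e y≈0)) , trans (*-congˡ (sym e)) xy)
    (λ y → ¬? (y ≟ 0#) ×-dec ((x * y) ≟ 0#))

  U : FiniteSetoid _ _
  U = subset (elements R) IsUnit isUnit-resp isUnit?

  Z* : FiniteSetoid _ _
  Z* = subset (elements R) IsNonZeroZeroDivisor
         isNonZeroZeroDivisor-resp isNonZeroZeroDivisor?

-- Loops are permitted: a nilpotent vertex x with x² = 0 is adjacent to itself
-- in the zero-divisor graph below.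
record Graph a ℓ b : Set (lsuc (a ⊔ ℓ ⊔ b)) where
  field
    V : FiniteSetoid a ℓ

  open Setoid (FiniteSetoid.carrier V) using (Carrier; _≈_)

  field
    Adj      : Rel Carrier b
    Adj-resp : Adj B.Respects₂ _≈_
    Adj-sym  : B.Symmetric Adj

open Graph public using (V)

Γ : (R : FiniteCommutativeRing c ℓ) → Graph (c ⊔ ℓ) ℓ ℓ
Γ R = record
  { V        = Z* R
  ; Adj      = λ (x , _) (y , _) → x * y ≈ 0#
  ; Adj-resp = (λ e xy → trans (*-congˡ (sym e)) xy)
             , (λ e xy → trans (*-congʳ (sym e)) xy)
  ; Adj-sym  = λ {(x , _)} {(y , _)} xy → trans (*-comm y x) xy
  }
  where open FiniteCommutativeRing R

UnitGraph : (R : FiniteCommutativeRing c ℓ) → Graph (c ⊔ ℓ) ℓ 0ℓ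
UnitGraph R = record
  { V        = U R
  ; Adj      = λ _ _ → ⊥
  ; Adj-resp = (λ _ ()) , (λ _ ())
  ; Adj-sym  = λ ()
  }

{-# OPTIONS --safe #-}

-- In a finite commutative ring every element x is a unit or a zero-divisor:
-- the |R| + 1 elements 1 and x y (y ∈ R) of R cannot be distinct, so x y = 1
-- for some y, or x (y - z) = 0 for some y ≠ z.  Hence R is the disjoint union
-- of {0}, U(R) and Z*(R), and it remains to note that both |R| and |U(R)| are
-- multiplicative in direct products.
module Submission where

open import Defs
open import Algebra.Bundles using (CommutativeRing)
open import Algebra.Morphism.Structures using (module RingMorphisms)
import Algebra.Properties.Ring as RingProperties
open import Data.Fin.Base using (Fin; zero; suc)
open import Data.Fin.Permutation using (↔⇒≡)
open import Data.Fin.Properties using (pigeonhole; 1↔⊤; +↔⊎; *↔×; <⇒≢)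
open import Data.Integer.Base using (+_; _-_)
open import Data.Integer.Properties using (pos-+)
open import Data.Integer.Tactic.RingSolver using (solve-∀)
open import Data.Nat.Base using (ℕ; _≤_; _+_)
import Data.Nat.Properties as ℕ
open import Data.Product.Base using (∃; _×_; _,_; proj₁; proj₂)
open import Data.Product.Function.NonDependent.Setoid using (_×-inverse_)
open import Data.Product.Relation.Binary.Pointwise.NonDependent as Product using (_×ₛ_)
open import Data.Sum.Base using (_⊎_; inj₁; inj₂)
open import Data.Sum.Function.Setoid using (_⊎-inverse_)
open import Data.Sum.Relation.Binary.Pointwise as Sum using (_⊎ₛ_; inj₁; inj₂)
open import Data.Unit.Base using (⊤; tt)
open import Function.Base using (_∘_)
open import Function.Bundles using (Bijection; Injection; Inverse)
open import Function.Properties.Bijection using (Bijection⇒Inverse)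
import Function.Properties.Inverse as Inv
open import Level using (Level; _⊔_; 0ℓ)
open import Relation.Binary.Bundles using (Setoid)
open import Relation.Binary.PropositionalEquality
  using (_≡_; refl; sym; cong; setoid; module ≡-Reasoning)
import Relation.Binary.Reasoning.Setoid as ≈-Reasoning
open import Relation.Nullary.Decidable using (yes; no)
open import Relation.Nullary.Negation using (¬_; contradiction)

private
  variable
    a b c c′ ℓ ℓ′ : Level

open FiniteSetoid using (carrier; enumeration)

-- Cardinalities of sums and products of finite setoids

#-cong : (S : FiniteSetoid a ℓ) (T : FiniteSetoid b ℓ′) →
         Inverse (carrier S) (carrier T) → # S ≡ # T
#-cong S T S↔T = ↔⇒≡
  (Inv.trans (Inv.sym (enumeration S)) (Inv.trans S↔T (enumeration T)))

-- Plays the part of the class {0} when the ring is partitioned.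
⊤ᶠ : FiniteSetoid 0ℓ 0ℓ
⊤ᶠ = record { carrier = setoid ⊤ ; size = 1 ; enumeration = Inv.sym 1↔⊤ }

infixr 1 _⊎ᶠ_

_⊎ᶠ_ : FiniteSetoid a ℓ → FiniteSetoid b ℓ′ → FiniteSetoid (a ⊔ b) (a ⊔ b ⊔ ℓ ⊔ ℓ′)
S ⊎ᶠ T = record
  { carrier     = carrier S ⊎ₛ carrier T
  ; size        = # S + # T
  ; enumeration =
      Inv.trans (enumeration S ⊎-inverse enumeration T)
        (Inv.trans (Sum.Pointwise-≡↔≡ _ _) (Inv.sym +↔⊎))
  }

-- Pointwise equality avoids function extensionality and agrees by definition with the equality of
-- `∏ᴿ`.
Πₛ : ∀ {r} → (Fin r → Setoid a ℓ) → Setoid a ℓ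
Πₛ S = record
  { Carrier       = ∀ i → Setoid.Carrier (S i)
  ; _≈_           = λ f g → ∀ i → Setoid._≈_ (S i) (f i) (g i)
  ; isEquivalence = record
    { refl  = λ i → Setoid.refl (S i)
    ; sym   = λ e i → Setoid.sym (S i) (e i)
    ; trans = λ e e′ i → Setoid.trans (S i) (e i) (e′ i)
    }
  }

Π-empty : (S : Fin 0 → Setoid a ℓ) → Inverse (Πₛ S) (setoid (Fin 1))
Π-empty _ = record
  { to        = λ _ → zero
  ; from      = λ _ ()
  ; to-cong   = λ _ → refl
  ; from-cong = λ _ ()
  ; inverse   = (λ { {zero} _ → refl }) , λ _ ()
  }

Π-uncons : ∀ {r} (S : Fin (ℕ.suc r) → Setoid a ℓ) →
           Inverse (Πₛ S) (S zero ×ₛ Πₛ (S ∘ suc))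
Π-uncons _ = record
  { to        = λ f → f zero , f ∘ suc
  ; from      = λ { (x , f) zero → x ; (x , f) (suc i) → f i }
  ; to-cong   = λ e → e zero , e ∘ suc
  ; from-cong = λ { (e , e′) zero → e ; (e , e′) (suc i) → e′ i }
  ; inverse   = (λ e → e zero , e ∘ suc)
              , λ { (e , e′) zero → e ; (e , e′) (suc i) → e′ i }
  }

-- The recursion follows the unfolding of `∏`: the empty product is 1, matching the single function
-- on `Fin 0`, and each further factor splits off the value at `zero`.
enumerate-Π : ∀ {r} (S : Fin r → FiniteSetoid a ℓ) →
              Inverse (Πₛ (carrier ∘ S)) (setoid (Fin (∏ (λ i → # S i))))
enumerate-Π {r = ℕ.zero}  S = Π-empty (carrier ∘ S)
enumerate-Π {r = ℕ.suc _} S =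
  Inv.trans (Π-uncons (carrier ∘ S))
    (Inv.trans (enumeration (S zero) ×-inverse enumerate-Π (S ∘ suc))
      (Inv.trans Product.Pointwise-≡↔≡ (Inv.sym *↔×)))

Πᶠ : ∀ {r} → (Fin r → FiniteSetoid a ℓ) → FiniteSetoid a ℓ
Πᶠ S = record
  { carrier = Πₛ (carrier ∘ S) ; size = ∏ (λ i → # S i) ; enumeration = enumerate-Π S }

-- Partition of a finite ring into zero, units and non-zero zero-divisors

module _ (R : FiniteCommutativeRing c ℓ) where

  private
    module R = FiniteCommutativeRing R
    open R using (Carrier; _≈_; _*_; 0#; 1#; ≈-setoid)
    open RingProperties R.ring using (x[y-z]≈xy-xz; x∙y⁻¹≈ε⇒x≈y; x≈y⇒x∙y⁻¹≈ε)
    open ≈-Reasoning ≈-setoid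

    module E = Inverse R.enumeration
    open Injection (Inv.Inverse⇒Injection R.enumeration) using () renaming (injective to to-injective)
    open Injection (Inv.Inverse⇒Injection (Inv.sym R.enumeration)) using () renaming (injective to from-injective)

  unit∨zeroDivisor : ∀ x → IsUnit R x ⊎ IsZeroDivisor R x
  unit∨zeroDivisor x with pigeonhole (ℕ.n<1+n R.size) 1∷x*_
    where
    1∷x*_ : Fin (ℕ.suc R.size) → Fin R.size
    1∷x*_ zero    = E.to 1#
    1∷x*_ (suc i) = E.to (x * E.from i)
  -- The colliding indices come in increasing order, so only the first can be `zero`, the index of
  -- the entry `1#`.
  ... | zero , suc j , _ , e = inj₁ (y , R.trans (R.*-comm y x) xy≈1 , xy≈1)
    where
    y = E.from j
    xy≈1 : x * y ≈ 1#
    xy≈1 = R.sym (to-injective e)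
  ... | suc i , suc j , i<j , e = inj₂ (y R.- z , y-z≉0 , x[y-z]≈0)
    where
    y = E.from i
    z = E.from j
    y-z≉0 : ¬ (y R.- z ≈ 0#)
    y-z≉0 y-z≈0 = <⇒≢ i<j (cong suc
      (from-injective (x∙y⁻¹≈ε⇒x≈y y z y-z≈0)))
    x[y-z]≈0 : x * (y R.- z) ≈ 0#
    x[y-z]≈0 = R.trans (x[y-z]≈xy-xz x y z)
      (x≈y⇒x∙y⁻¹≈ε (to-injective e))

  unit⇒¬zeroDivisor : ∀ {x} → IsUnit R x → ¬ IsZeroDivisor R x
  unit⇒¬zeroDivisor {x} (u , ux≈1 , _) (y , y≉0 , xy≈0) = y≉0 (begin
    y            ≈⟨ R.*-identityˡ y ⟨
    1# * y       ≈⟨ R.*-congʳ ux≈1 ⟨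
    (u * x) * y  ≈⟨ R.*-assoc u x y ⟩
    u * (x * y)  ≈⟨ R.*-congˡ xy≈0 ⟩
    u * 0#       ≈⟨ R.zeroʳ u ⟩
    0#           ∎)

  -- Zero is itself a zero-divisor, with witness `1#`, because `1#` is non-zero.
  unit⇒≉0 : ∀ {x} → IsUnit R x → ¬ (x ≈ 0#)
  unit⇒≉0 x∈U x≈0 = unit⇒¬zeroDivisor x∈U (1# , R.1≉0 , R.trans (R.*-identityʳ _) x≈0)

  -- For the map forgetting the class of an element, injectivity is disjointness of the three
  -- classes and surjectivity is their exhaustiveness.
  0⊎U⊎Z*↔R : Inverse (carrier (⊤ᶠ ⊎ᶠ U R ⊎ᶠ Z* R)) ≈-setoid
  0⊎U⊎Z*↔R = Bijection⇒Inverse record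
    { to        = f
    ; cong      = λ {x} {y} → f-cong {x} {y}
    ; bijective = (λ {x} {y} → f-injective x y)
                , λ x → let p , e = f-surjective x in
                    p , λ {q} q≈p → R.trans (f-cong {q} {p} q≈p) e
    }
    where
    open Setoid (carrier (⊤ᶠ ⊎ᶠ U R ⊎ᶠ Z* R)) renaming (Carrier to P; _≈_ to _≈ᴾ_) using ()

    f : P → Carrier
    f (inj₁ tt)             = 0#
    f (inj₂ (inj₁ (x , _))) = x
    f (inj₂ (inj₂ (x , _))) = x

    f-cong : ∀ {p q} → p ≈ᴾ q → f p ≈ f q
    f-cong (inj₁ _)        = R.refl
    f-cong (inj₂ (inj₁ e)) = e
    f-cong (inj₂ (inj₂ e)) = e

    f-injective : ∀ p q → f p ≈ f q → p ≈ᴾ q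
    f-injective (inj₁ _) (inj₁ _) _ = inj₁ refl
    f-injective (inj₁ _) (inj₂ (inj₁ (_ , u))) e = contradiction (R.sym e) (unit⇒≉0 u)
    f-injective (inj₁ _) (inj₂ (inj₂ (_ , z))) e = contradiction (R.sym e) (proj₁ z)
    f-injective (inj₂ (inj₁ (_ , u))) (inj₁ _) e = contradiction e (unit⇒≉0 u)
    f-injective (inj₂ (inj₂ (_ , z))) (inj₁ _) e = contradiction e (proj₁ z)
    f-injective (inj₂ (inj₁ _)) (inj₂ (inj₁ _)) e = inj₂ (inj₁ e)
    f-injective (inj₂ (inj₂ _)) (inj₂ (inj₂ _)) e = inj₂ (inj₂ e)
    f-injective (inj₂ (inj₁ (_ , u))) (inj₂ (inj₂ (_ , z))) e =
      contradiction (proj₂ z) (unit⇒¬zeroDivisor (isUnit-resp R e u))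
    f-injective (inj₂ (inj₂ (_ , z))) (inj₂ (inj₁ (_ , u))) e =
      contradiction (proj₂ z) (unit⇒¬zeroDivisor (isUnit-resp R (R.sym e) u))

    f-surjective : ∀ x → ∃ λ p → f p ≈ x
    -- Zero is tested first: it counts as a zero-divisor but lies outside `Z*`.
    f-surjective x with finite-≟ (elements R) x 0# | unit∨zeroDivisor x
    ... | yes x≈0 | _      = inj₁ tt , R.sym x≈0
    ... | no _    | inj₁ u = inj₂ (inj₁ (x , u)) , R.refl
    ... | no x≉0  | inj₂ z = inj₂ (inj₂ (x , x≉0 , z)) , R.refl

  #R≡1+#U+#Z* : # elements R ≡ 1 + (# U R + # Z* R)
  #R≡1+#U+#Z* = sym (#-cong (⊤ᶠ ⊎ᶠ U R ⊎ᶠ Z* R) (elements R) 0⊎U⊎Z*↔R)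

-- Transport of elements and units along the isomorphism

module _ {r} (R : FiniteCommutativeRing c ℓ) (Rᵢ : Fin r → FiniteCommutativeRing c′ ℓ′)
         (R≅ΠRᵢ : commutativeRing R ≅ ∏ᴿ (λ i → commutativeRing (Rᵢ i))) where

  private
    module R = FiniteCommutativeRing R
    module Π = CommutativeRing (∏ᴿ (λ i → commutativeRing (Rᵢ i)))
    open R using (Carrier; _≈_; _*_; 1#)

    ⟦_⟧ = proj₁ R≅ΠRᵢ
    open RingMorphisms.IsRingIsomorphism (proj₂ R≅ΠRᵢ)
      using (⟦⟧-cong; *-homo; 1#-homo; injective; surjective)

    ⟦_⟧⁻¹ : Π.Carrier → Carrier
    ⟦ y ⟧⁻¹ = proj₁ (surjective y)

    ⟦⟧∘⟦⟧⁻¹ : ∀ y → ⟦ ⟦ y ⟧⁻¹ ⟧ Π.≈ y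
    ⟦⟧∘⟦⟧⁻¹ y = proj₂ (surjective y) R.refl

    *≈1⇒⟦⟧*⟦⟧≈1 : ∀ {x y} → x * y ≈ 1# → ⟦ x ⟧ Π.* ⟦ y ⟧ Π.≈ Π.1#
    *≈1⇒⟦⟧*⟦⟧≈1 {x} {y} e = Π.trans (Π.sym (*-homo x y)) (Π.trans (⟦⟧-cong e) 1#-homo)

    -- Preimages are merely chosen by surjectivity, so the equation is verified after applying `⟦_⟧`
    -- and pulled back by injectivity.
    *≈1⇒⟦⟧⁻¹*⟦⟧⁻¹≈1 : ∀ {x y} → x Π.* y Π.≈ Π.1# → ⟦ x ⟧⁻¹ * ⟦ y ⟧⁻¹ ≈ 1#
    *≈1⇒⟦⟧⁻¹*⟦⟧⁻¹≈1 {x} {y} e = injective (Π.trans (*-homo _ _)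
      (Π.trans (Π.*-cong (⟦⟧∘⟦⟧⁻¹ x) (⟦⟧∘⟦⟧⁻¹ y)) (Π.trans e (Π.sym 1#-homo))))

  #R≡∏#Rᵢ : # elements R ≡ ∏ (λ i → # elements (Rᵢ i))
  #R≡∏#Rᵢ = #-cong (elements R) (Πᶠ (elements ∘ Rᵢ)) (Bijection⇒Inverse record
    { to = ⟦_⟧ ; cong = ⟦⟧-cong ; bijective = injective , surjective })

  -- Invertibility in a product is componentwise: an inverse has inverse components, and conversely
  -- the chosen inverses of the components assemble into one.
  U↔ΠUᵢ : Inverse (carrier (U R)) (carrier (Πᶠ (U ∘ Rᵢ)))
  U↔ΠUᵢ = Bijection⇒Inverse record
    { to        = λ (x , y , yx≈1 , xy≈1) i →
        ⟦ x ⟧ i , ⟦ y ⟧ i , *≈1⇒⟦⟧*⟦⟧≈1 yx≈1 i , *≈1⇒⟦⟧*⟦⟧≈1 xy≈1 i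
    ; cong      = ⟦⟧-cong
    -- Equality of units ignores the inverses, so injectivity of the ring isomorphism suffices.
    ; bijective = injective , λ u →
        let x = λ i → proj₁ (u i)
            y = λ i → proj₁ (proj₂ (u i))
        in ( ⟦ x ⟧⁻¹ , ⟦ y ⟧⁻¹
           , *≈1⇒⟦⟧⁻¹*⟦⟧⁻¹≈1 {y} {x} (λ i → proj₁ (proj₂ (proj₂ (u i))))
           , *≈1⇒⟦⟧⁻¹*⟦⟧⁻¹≈1 {x} {y} (λ i → proj₂ (proj₂ (proj₂ (u i)))) )
         , proj₂ (surjective x)
    }

  #U≡∏#Uᵢ : # U R ≡ ∏ (λ i → # U (Rᵢ i))
  #U≡∏#Uᵢ = #-cong (U R) (Πᶠ (U ∘ Rᵢ)) U↔ΠUᵢ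

-- The count, with untruncated subtraction in the integers

n≡1+u+z⇒z≡n-u-1 : ∀ {n u z} → n ≡ 1 + (u + z) → + z ≡ + n - + u - + 1
n≡1+u+z⇒z≡n-u-1 {u = u} {z} refl
  -- Distributing the embedding of the naturals over both sums leaves an identity of integer
  -- polynomials.
  rewrite pos-+ 1 (u + z) | pos-+ u z = lemma (+ u) (+ z)
  where
  open import Data.Integer.Base as ℤ using (ℤ)
  lemma : ∀ (x y : ℤ) → y ≡ (+ 1 ℤ.+ (x ℤ.+ y)) - x - + 1
  lemma = solve-∀

theorem3p1 : ∀ {c ℓ c′ ℓ′ : Level} (r : ℕ) → 1 ≤ r →
    (R : FiniteCommutativeRing c ℓ) (Rᵢ : Fin r → FiniteCommutativeRing c′ ℓ′) →
    (∀ i → IsLocal (commutativeRing (Rᵢ i))) →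
    commutativeRing R ≅ ∏ᴿ (λ i → commutativeRing (Rᵢ i)) →
    (# Z* R ≡ # V (Γ R)) ×
    (+ (# V (Γ R)) ≡ + ∏ (λ i → # elements (Rᵢ i)) - + ∏ (λ i → # V (UnitGraph (Rᵢ i))) - + 1) ×
    (+ ∏ (λ i → # elements (Rᵢ i)) - + ∏ (λ i → # V (UnitGraph (Rᵢ i))) - + 1
    ≡ + ∏ (λ i → # elements (Rᵢ i)) - + ∏ (λ i → # U (Rᵢ i)) - + 1)
-- Both `refl`s hold because the vertex sets of `Γ` and `UnitGraph` are by definition `Z*` and `U`.
theorem3p1 r _ R Rᵢ _ R≅ΠRᵢ = refl , n≡1+u+z⇒z≡n-u-1 ∏#Rᵢ≡1+∏#Uᵢ+#Z* , refl
  where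
  open ≡-Reasoning
  ∏#Rᵢ≡1+∏#Uᵢ+#Z* : ∏ (λ i → # elements (Rᵢ i)) ≡ 1 + (∏ (λ i → # U (Rᵢ i)) + # Z* R)
  ∏#Rᵢ≡1+∏#Uᵢ+#Z* = begin
    ∏ (λ i → # elements (Rᵢ i))           ≡⟨ #R≡∏#Rᵢ R Rᵢ R≅ΠRᵢ ⟨
    # elements R                          ≡⟨ #R≡1+#U+#Z* R ⟩
    1 + (# U R + # Z* R)                  ≡⟨ cong (λ n → 1 + (n + # Z* R)) (#U≡∏#Uᵢ R Rᵢ R≅ΠRᵢ) ⟩
    1 + (∏ (λ i → # U (Rᵢ i)) + # Z* R)   ∎
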